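{- Let $d \geq 2$ be an integer, let $\mathbb{F}$ be a field, and let $V$ be a vector space over $\mathbb{F}$ of dimension $d+1$. Let $\Phi = (A; \{E_i\}_{i=0}^d; A^*; \{E^*_i\}_{i=0}^d)$ be a Hessenberg system on $V$. If $\Phi$ is TD, then $\Phi$ is recurrent (REC).
   Context: $\mathrm{End}(V)$ is the algebra of $\mathbb{F}$-linear maps $V\to V$. An element of $\mathrm{End}(V)$ is multiplicity-free if it is diagonalizable and every eigenspace has dimension one. For multiplicity-free $A$ with eigenspaces ordered $V_0,\dots,V_d$, the corresponding primitive idempotents are $E_0,\dots,E_d \in \mathrm{End}(V)$, where $E_i$ acts as the identity on $V_i$ and as $0$ on $V_j$ for $j\neq i$. The superscript $*$ in $A^*$, $E_i^*$, $\theta_i^*$ is just notation (not an adjoint). A Hessenberg system on $V$ is a sequence $\Phi=(A; \{E_i\}_{i=0}^d; A^*; \{E^*_i\}_{i=0}^d)$ of elements of $\mathrm{End}(V)$ such that: (i) $A$ and $A^*$ are multiplicity-free; (ii) $\{E_i\}_{i=0}^d$ is an ordering of the primitive idempotents of $A$; (iii) $\{E^*_i\}_{i=0}^d$ is an ordering of the primitive idempotents of $A^*$; (iv) for $0\le i,j\le d$, $E_iA^*E_j=0$ if $i-j>1$ and $E_iA^*E_j\neq 0$ if $i-j=1$; (v) for $0\le i,j\le d$, $E^*_iAE^*_j=0$ if $i-j>1$ and $E^*_iAE^*_j\neq 0$ if $i-j=1$. The eigenvalue sequence $\{\theta_i\}_{i=0}^d$ (resp. dual eigenvalue sequence $\{\theta^*_i\}_{i=0}^d$)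 of $\Phi$ is defined by letting $\theta_i$ (resp. $\theta^*_i$) be the eigenvalue of $A$ (resp. $A^*$) on $E_iV$ (resp. $E^*_iV$). A sequence $\{\sigma_i\}_{i=0}^n$ in $\mathbb{F}$ is $\beta$-recurrent ($\beta\in\mathbb{F}$) if $\sigma_{i-2}-(\beta+1)\sigma_{i-1}+(\beta+1)\sigma_i-\sigma_{i+1}=0$ for $2\le i\le n-1$ (a vacuous condition if $n=2$). $\Phi$ is recurrent (REC) if there exists $\beta\in\mathbb{F}$ such that each of $\{\theta_i\}_{i=0}^d$ and $\{\theta^*_i\}_{i=0}^d$ is $\beta$-recurrent. $\Phi$ is TD if there exist scalars $\beta,\gamma,\gamma^*,\varrho,\varrho^*\in\mathbb{F}$ such that $$0=[A, A^2A^*-\beta AA^*A+A^*A^2-\gamma(AA^*+A^*A)-\varrho A^*],$$ $$0=[A^*, A^{*2}A-\beta A^*AA^*+AA^{*2}-\gamma^*(A^*A+AA^*)-\varrho^*A],$$ where $[X,Y]=XY-YX$. -}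

module Defs where

open import Algebra.Apartness.Bundles using (HeytingCommutativeRing; HeytingField)
open import Algebra.Bundles using (CommutativeMonoid; CommutativeRing)
open import Algebra.Module.Bundles using (Module)
import Algebra.Definitions.RawMonoid as RawMonoidDefinitions
import Algebra.Module.Morphism.Construct.Composition as Composition
import Algebra.Module.Morphism.Structures as MorphismStructures
import Algebra.Properties.AbelianGroup as AbelianGroupProperties
import Algebra.Properties.CommutativeSemigroup as CommutativeSemigroupProperties
open import Data.Fin.Base using (Fin; toℕ)
open import Data.Nat.Base as ℕ using (ℕ; suc)
open import Data.Product.Base using (Σ-syntax; ∃-syntax; _×_)
open import Function.Definitions using (Injective)
open import Level using (Level; _⊔_)
open import Relation.Binary.Core using (Rel)
open import Relation.Binary.PropositionalEquality.Core using (_≡_; _≢_)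
open import Relation.Nullary.Negation.Core using (¬_)
open import Relation.Unary using (Pred; U)

-- Fields are the library's Heyting fields.  Classically these are exactly the
-- fields, the apartness x # y being equivalent to ¬ (x ≈ y); constructively
-- they include every field with decidable equality.  All hypotheses of the
-- form "x ≠ y" below are stated with the (weaker) negated equality.
fieldRing : ∀ {c ℓ₁ ℓ₂} → HeytingField c ℓ₁ ℓ₂ → CommutativeRing c ℓ₁
fieldRing F = HeytingCommutativeRing.commutativeRing (HeytingField.heytingCommutativeRing F)

VectorSpace : ∀ {c ℓ₁ ℓ₂} → HeytingField c ℓ₁ ℓ₂ → (m ℓm : Level) → Set _
VectorSpace F m ℓm = Module (fieldRing F) m ℓm

module OverVectorSpace {c ℓ₁ ℓ₂ m ℓm : Level} (F : HeytingField c ℓ₁ ℓ₂) (V : VectorSpace F m ℓm) where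

  open HeytingField F using (Carrier; _≈_; _+_; _*_; _-_; 0#; 1#)
  open Module V
  open RawMonoidDefinitions +ᴹ-rawMonoid using (sum)
  open MorphismStructures.ModuleMorphisms rawModule rawModule using (IsModuleHomomorphism)

  linearCombination : ∀ {n} → (Fin n → Carrier) → (Fin n → Carrierᴹ) → Carrierᴹ
  linearCombination a b = sum (λ i → a i *ₗ b i)

  record IsBasis {p n} (W : Pred Carrierᴹ p) (b : Fin n → Carrierᴹ) : Set (c ⊔ ℓ₁ ⊔ m ⊔ ℓm ⊔ p) where
    field
      members     : ∀ i → W (b i)
      independent : ∀ a → linearCombination a b ≈ᴹ 0ᴹ → ∀ i → a i ≈ 0#
      spanning    : ∀ v → W v → ∃[ a ] v ≈ᴹ linearCombination a b

  SubspaceHasDimension : ∀ {p} → Pred Carrierᴹ p → ℕ → Set (c ⊔ ℓ₁ ⊔ m ⊔ ℓm ⊔ p)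
  SubspaceHasDimension W n = Σ[ b ∈ (Fin n → Carrierᴹ) ] IsBasis W b

  HasDimension : ℕ → Set (c ⊔ ℓ₁ ⊔ m ⊔ ℓm)
  HasDimension = SubspaceHasDimension U

  record End : Set (c ⊔ m ⊔ ℓm) where
    field
      ⟦_⟧                  : Carrierᴹ → Carrierᴹ
      isModuleHomomorphism : IsModuleHomomorphism ⟦_⟧

    open IsModuleHomomorphism isModuleHomomorphism public
      using (⟦⟧-cong; +ᴹ-homo; *ₗ-homo; *ᵣ-homo; 0ᴹ-homo; -ᴹ-homo)

  open End

  private
    mkEnd : (f : Carrierᴹ → Carrierᴹ) →
            (∀ {v w} → v ≈ᴹ w → f v ≈ᴹ f w) →
            (∀ v w → f (v +ᴹ w) ≈ᴹ f v +ᴹ f w) →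
            (∀ s v → f (s *ₗ v) ≈ᴹ s *ₗ f v) → End
    mkEnd f f-cong f-+ f-* = record
      { ⟦_⟧ = f
      ; isModuleHomomorphism = record
        { isBimoduleHomomorphism = record
          { +ᴹ-isGroupHomomorphism = record
            { isMonoidHomomorphism = record
              { isMagmaHomomorphism = record
                { isRelHomomorphism = record { cong = f-cong }
                ; homo = f-+
                }
              ; ε-homo = f-0
              }
            ; ⁻¹-homo = λ v → uniqueʳ‿-ᴹ (f v) (f (-ᴹ v))
                (≈ᴹ-trans (≈ᴹ-sym (f-+ v (-ᴹ v))) (≈ᴹ-trans (f-cong (-ᴹ‿inverseʳ v)) f-0))
            }
          ; *ₗ-homo = f-*
          ; *ᵣ-homo = λ s v → ≈ᴹ-trans (f-cong (≈ᴹ-sym (*ₗ-*ᵣ-coincident s v)))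
                        (≈ᴹ-trans (f-* s v) (*ₗ-*ᵣ-coincident s (f v)))
          }
        }
      }
      where
      f-0 : f 0ᴹ ≈ᴹ 0ᴹ
      f-0 = ≈ᴹ-trans (f-cong (≈ᴹ-sym (*ₗ-zeroˡ 0ᴹ))) (≈ᴹ-trans (f-* 0# 0ᴹ) (*ₗ-zeroˡ (f 0ᴹ)))

    +ᴹ-interchange : ∀ u v w x → (u +ᴹ v) +ᴹ (w +ᴹ x) ≈ᴹ (u +ᴹ w) +ᴹ (v +ᴹ x)
    +ᴹ-interchange = CommutativeSemigroupProperties.interchange
      (CommutativeMonoid.commutativeSemigroup +ᴹ-commutativeMonoid)

  infix  4 _≈ᴱ_ _≉ᴱ_
  infixl 6 _+ᴱ_ _-ᴱ_
  infixr 7 _·ᴱ_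
  infixl 8 _∘ᴱ_
  infix  8 -ᴱ_

  _≈ᴱ_ : Rel End (m ⊔ ℓm)
  f ≈ᴱ g = ∀ v → ⟦ f ⟧ v ≈ᴹ ⟦ g ⟧ v

  _≉ᴱ_ : Rel End (m ⊔ ℓm)
  f ≉ᴱ g = ¬ (f ≈ᴱ g)

  0ᴱ : End
  0ᴱ = mkEnd (λ _ → 0ᴹ) (λ _ → ≈ᴹ-refl) (λ _ _ → ≈ᴹ-sym (+ᴹ-identityˡ 0ᴹ))
         (λ s _ → ≈ᴹ-sym (*ₗ-zeroʳ s))

  _∘ᴱ_ : End → End → End
  f ∘ᴱ g = record
    { ⟦_⟧ = λ v → ⟦ f ⟧ (⟦ g ⟧ v)
    ; isModuleHomomorphism = Composition.isModuleHomomorphism ≈ᴹ-trans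
        (isModuleHomomorphism g) (isModuleHomomorphism f)
    }

  _+ᴱ_ : End → End → End
  f +ᴱ g = mkEnd (λ v → ⟦ f ⟧ v +ᴹ ⟦ g ⟧ v)
    (λ v≈w → +ᴹ-cong (⟦⟧-cong f v≈w) (⟦⟧-cong g v≈w))
    (λ v w → ≈ᴹ-trans (+ᴹ-cong (+ᴹ-homo f v w) (+ᴹ-homo g v w)) (+ᴹ-interchange _ _ _ _))
    (λ s v → ≈ᴹ-trans (+ᴹ-cong (*ₗ-homo f s v) (*ₗ-homo g s v)) (≈ᴹ-sym (*ₗ-distribˡ s _ _)))

  _·ᴱ_ : Carrier → End → End
  s ·ᴱ f = mkEnd (λ v → s *ₗ ⟦ f ⟧ v)
    (λ v≈w → *ₗ-congˡ (⟦⟧-cong f v≈w))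
    (λ v w → ≈ᴹ-trans (*ₗ-congˡ (+ᴹ-homo f v w)) (*ₗ-distribˡ s _ _))
    (λ t v → ≈ᴹ-trans (*ₗ-congˡ (*ₗ-homo f t v)) (*ₗ-comm s t (⟦ f ⟧ v)))

  -ᴱ_ : End → End
  -ᴱ f = mkEnd (λ v → -ᴹ ⟦ f ⟧ v)
    (λ v≈w → -ᴹ‿cong (⟦⟧-cong f v≈w))
    (λ v w → ≈ᴹ-trans (-ᴹ‿cong (+ᴹ-homo f v w)) (≈ᴹ-sym (⁻¹-∙-comm _ _)))
    (λ s v → ≈ᴹ-trans (-ᴹ‿cong (*ₗ-homo f s v)) (≈ᴹ-sym (*ₗ-negʳ s (⟦ f ⟧ v))))
    where
    open AbelianGroupProperties +ᴹ-abelianGroup using (⁻¹-∙-comm)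
    *ₗ-negʳ : ∀ s v → s *ₗ (-ᴹ v) ≈ᴹ -ᴹ (s *ₗ v)
    *ₗ-negʳ s v = uniqueʳ‿-ᴹ (s *ₗ v) (s *ₗ (-ᴹ v))
      (≈ᴹ-trans (≈ᴹ-sym (*ₗ-distribˡ s v (-ᴹ v)))
        (≈ᴹ-trans (*ₗ-congˡ (-ᴹ‿inverseʳ v)) (*ₗ-zeroʳ s)))

  _-ᴱ_ : End → End → End
  f -ᴱ g = f +ᴱ -ᴱ g

  [_,_] : End → End → End
  [ f , g ] = f ∘ᴱ g -ᴱ g ∘ᴱ f

  Eigenspace : End → Carrier → Pred Carrierᴹ ℓm
  Eigenspace A θ v = ⟦ A ⟧ v ≈ᴹ θ *ₗ v

  IsEigenvector : End → Carrier → Pred Carrierᴹ ℓm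
  IsEigenvector A θ v = v ≉ᴹ 0ᴹ × Eigenspace A θ v

  IsEigenvalue : End → Pred Carrier (m ⊔ ℓm)
  IsEigenvalue A θ = ∃[ v ] IsEigenvector A θ v

  Diagonalizable : End → Set (c ⊔ ℓ₁ ⊔ m ⊔ ℓm)
  Diagonalizable A =
    ∃[ n ] Σ[ b ∈ (Fin n → Carrierᴹ) ] IsBasis U b × (∀ i → ∃[ μ ] IsEigenvector A μ (b i))

  record MultiplicityFree (A : End) : Set (c ⊔ ℓ₁ ⊔ m ⊔ ℓm) where
    field
      diagonalizable : Diagonalizable A
      eigenspaceDim  : ∀ μ → IsEigenvalue A μ → SubspaceHasDimension (Eigenspace A μ) 1

  -- An ordering V₀, …, Vₙ₋₁ of the eigenspaces of A is encoded by the sequence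
  -- of the corresponding eigenvalues, each eigenvalue occurring exactly once.
  record IsEigenvalueOrdering {n} (A : End) (θ : Fin n → Carrier) : Set (c ⊔ ℓ₁ ⊔ m ⊔ ℓm) where
    field
      isEigenvalue : ∀ i → IsEigenvalue A (θ i)
      distinct     : Injective _≡_ _≈_ θ
      exhaustive   : ∀ μ → IsEigenvalue A μ → ∃[ i ] μ ≈ θ i

  record ArePrimitiveIdempotents {n} (A : End) (E : Fin n → End) : Set (c ⊔ ℓ₁ ⊔ m ⊔ ℓm) where
    field
      eigenvalueAt       : Fin n → Carrier
      eigenspaceOrdering : IsEigenvalueOrdering A eigenvalueAt
      identityOnOwn      : ∀ i v → Eigenspace A (eigenvalueAt i) v → ⟦ E i ⟧ v ≈ᴹ v
      zeroOnOthers       : ∀ i j v → j ≢ i → Eigenspace A (eigenvalueAt j) v → ⟦ E i ⟧ v ≈ᴹ 0ᴹ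

  record HessenbergSystem (d : ℕ) : Set (c ⊔ ℓ₁ ⊔ m ⊔ ℓm) where
    field
      A  : End
      E  : Fin (suc d) → End
      A* : End
      E* : Fin (suc d) → End

      A-multiplicityFree  : MultiplicityFree A
      A*-multiplicityFree : MultiplicityFree A*

      E-primitiveIdempotents  : ArePrimitiveIdempotents A E
      E*-primitiveIdempotents : ArePrimitiveIdempotents A* E*

      EA*E-zero    : ∀ i j → toℕ i ℕ.> suc (toℕ j) → E i ∘ᴱ A* ∘ᴱ E j ≈ᴱ 0ᴱ
      EA*E-nonzero : ∀ i j → toℕ i ≡ suc (toℕ j) → E i ∘ᴱ A* ∘ᴱ E j ≉ᴱ 0ᴱ

      E*AE*-zero    : ∀ i j → toℕ i ℕ.> suc (toℕ j) → E* i ∘ᴱ A ∘ᴱ E* j ≈ᴱ 0ᴱ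
      E*AE*-nonzero : ∀ i j → toℕ i ≡ suc (toℕ j) → E* i ∘ᴱ A ∘ᴱ E* j ≉ᴱ 0ᴱ

  -- θ i is the eigenvalue of A on the (nonzero) image E i V.
  IsEigenvalueSequence : ∀ {n} → End → (Fin n → End) → (Fin n → Carrier) → Set (m ⊔ ℓm)
  IsEigenvalueSequence A E θ = ∀ i → E i ≉ᴱ 0ᴱ × A ∘ᴱ E i ≈ᴱ θ i ·ᴱ E i

  -- For σ₀, …, σₙ; the indices h, i, j, k play the roles of i-2, i-1, i, i+1.
  IsRecurrentWith : ∀ {n} → Carrier → (Fin (suc n) → Carrier) → Set ℓ₁
  IsRecurrentWith β σ = ∀ h i j k →
    toℕ i ≡ suc (toℕ h) → toℕ j ≡ suc (toℕ i) → toℕ k ≡ suc (toℕ j) →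
    σ h - (β + 1#) * σ i + (β + 1#) * σ j - σ k ≈ 0#

  -- The eigenvalue sequences are given by their defining property, which
  -- determines them up to ≈.
  Recurrent : ∀ {d} → HessenbergSystem d → Set (c ⊔ ℓ₁ ⊔ m ⊔ ℓm)
  Recurrent {d} Φ =
    Σ[ θ ∈ (Fin (suc d) → Carrier) ] Σ[ θ* ∈ (Fin (suc d) → Carrier) ]
      IsEigenvalueSequence A E θ × IsEigenvalueSequence A* E* θ* ×
      (∃[ β ] IsRecurrentWith β θ × IsRecurrentWith β θ*)
    where open HessenbergSystem Φ

  TDExpression : Carrier → Carrier → Carrier → End → End → End
  TDExpression β γ ϱ X Y =
    [ X , X ∘ᴱ X ∘ᴱ Y -ᴱ β ·ᴱ (X ∘ᴱ Y ∘ᴱ X) +ᴱ Y ∘ᴱ X ∘ᴱ X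
          -ᴱ γ ·ᴱ (X ∘ᴱ Y +ᴱ Y ∘ᴱ X) -ᴱ ϱ ·ᴱ Y ]

  TD : ∀ {d} → HessenbergSystem d → Set (c ⊔ m ⊔ ℓm)
  TD Φ = ∃[ β ] ∃[ γ ] ∃[ γ* ] ∃[ ϱ ] ∃[ ϱ* ]
    (0ᴱ ≈ᴱ TDExpression β γ ϱ A A*) × (0ᴱ ≈ᴱ TDExpression β γ* ϱ* A* A)
    where open HessenbergSystem Φ

{-# OPTIONS --safe #-}

-- Multiplying the first TD relation by Eᵢ on the left and by Eⱼ on the right
-- gives (θᵢ − θⱼ) p(θᵢ, θⱼ) EᵢA*Eⱼ = 0, where
-- p(x, y) = x² − βxy + y² − γ(x + y) − ϱ.  For i = j + 1 the last factor is
-- nonzero, so p vanishes at consecutive eigenvalues.  As p is symmetric,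
-- p(θᵢ₊₁, θᵢ) − p(θᵢ, θᵢ₋₁) is divisible by θᵢ₊₁ − θᵢ₋₁, with quotient
-- θᵢ₋₁ − βθᵢ + θᵢ₊₁ − γ; eliminating γ between two consecutive such equations
-- gives the β-recurrence.

module Submission where

open import Defs
open import Algebra.Apartness.Bundles using (HeytingField)
open import Algebra.Bundles using (CommutativeRing)
open import Algebra.Module.Bundles using (Module)
import Algebra.Properties.Ring as RingProperties
import Algebra.Solver.Ring.NaturalCoefficients.Default as SemiringSolver
open import Data.Fin.Base using (Fin; zero; suc; toℕ)
open import Data.Fin.Properties using (_≟_)
open import Data.Nat.Base using (ℕ; zero; suc; _≥_)
open import Data.Nat.Properties using (m≢1+n+m)
open import Data.Product.Base using (_,_; proj₁)
open import Function.Base using (_∘_)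
open import Level using (Level)
open import Relation.Binary.PropositionalEquality.Core as ≡ using (_≡_; _≢_)
import Relation.Binary.Reasoning.Setoid as SetoidReasoning
open import Relation.Nullary.Decidable.Core using (yes; no)

-- Scalar arithmetic: cancellation, the quadratic p and the recurrence.

module FieldProperties {c ℓ₁ ℓ₂ : Level} (F : HeytingField c ℓ₁ ℓ₂) where

  open HeytingField F using (tight; #⇒invertible)
  open CommutativeRing (fieldRing F)
  open RingProperties ring using (+-cancelʳ; x∙y⁻¹≈ε⇒x≈y; -0#≈0#)
  open SetoidReasoning setoid
  open SemiringSolver commutativeSemiring

  -- Tightness turns "not apart from zero" into equality, and apartness from zero yields an inverse.
  -- This makes hypotheses of the form x ≉ y usable constructively.
  noLeftInverse⇒≈0 : ∀ {x} → (∀ y → y * x ≉ 1#) → x ≈ 0#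
  noLeftInverse⇒≈0 {x} noInverse = proj₁ (tight x 0#) λ x#0 →
    let (y , yx≈1 , _) = #⇒invertible x#0 in
    noInverse y (trans (*-congˡ (sym x-0≈x)) yx≈1)
    where
    x-0≈x : x - 0# ≈ x
    x-0≈x = trans (+-congˡ -0#≈0#) (+-identityʳ x)

  -- A mere negation x ≉ y does not let x - y be inverted, so the argument refutes an inverse of `z`
  -- instead.
  *-cancelˡ-≉ : ∀ {x y} z → x ≉ y → z * x ≈ z * y → z ≈ 0#
  *-cancelˡ-≉ {x} {y} z x≉y zx≈zy = noLeftInverse⇒≈0 λ w wz≈1 → x≉y (begin
    x           ≈⟨ *-identityˡ x ⟨
    1# * x      ≈⟨ *-congʳ wz≈1 ⟨
    w * z * x   ≈⟨ *-assoc w z x ⟩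
    w * (z * x) ≈⟨ *-congˡ zx≈zy ⟩
    w * (z * y) ≈⟨ *-assoc w z y ⟨
    w * z * y   ≈⟨ *-congʳ wz≈1 ⟩
    1# * y      ≈⟨ *-identityˡ y ⟩
    y           ∎)

  x-y+y≈x : ∀ x y → x - y + y ≈ x
  x-y+y≈x x y = trans (+-assoc x (- y) y) (trans (+-congˡ (-‿inverseˡ y)) (+-identityʳ x))

  x-y≈z⇒x≈z+y : ∀ {x y z} → x - y ≈ z → x ≈ z + y
  x-y≈z⇒x≈z+y {x} {y} eq = trans (sym (x-y+y≈x x y)) (+-congʳ eq)

  *-cancelˡ-nonZero : ∀ {x y z} → z ≉ 0# → z * x ≈ z * y → x ≈ y
  *-cancelˡ-nonZero {x} {y} {z} z≉0 zx≈zy =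
    x∙y⁻¹≈ε⇒x≈y x y (*-cancelˡ-≉ (x - y) z≉0 (begin
      (x - y) * z     ≈⟨ *-comm (x - y) z ⟩
      z * (x - y)     ≈⟨ +-cancelʳ (z * y) _ _ (begin
        z * (x - y) + z * y ≈⟨ distribˡ z (x - y) y ⟨
        z * (x - y + y)     ≈⟨ *-congˡ (x-y+y≈x x y) ⟩
        z * x               ≈⟨ zx≈zy ⟩
        z * y               ≈⟨ +-identityˡ (z * y) ⟨
        0# + z * y          ∎) ⟩
      0#              ≈⟨ zeroʳ (x - y) ⟨
      (x - y) * 0#    ∎))

  quadratic : (β γ ϱ x y : Carrier) → Carrier
  quadratic β γ ϱ x y = x * x - β * (x * y) + y * y - γ * (x + y) - ϱ

  -- The subtraction-free form of p(x, y) = 0, accessible to the semiring solver.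
  QuadraticZero : (β γ ϱ x y : Carrier) → Set ℓ₁
  QuadraticZero β γ ϱ x y = x * x + y * y ≈ β * (x * y) + (γ * (x + y) + ϱ)

  quadratic≈0⇒QuadraticZero : ∀ {β γ ϱ x y} →
    quadratic β γ ϱ x y ≈ 0# → QuadraticZero β γ ϱ x y
  quadratic≈0⇒QuadraticZero {β} {γ} {ϱ} {x} {y} eq = begin
    x * x + y * y                                 ≈⟨ +-congʳ (x-y+y≈x (x * x) (β * (x * y))) ⟨
    x * x - β * (x * y) + β * (x * y) + y * y     ≈⟨ solve 3 (λ a b c → a :+ b :+ c := b :+ (a :+ c)) refl _ _ _ ⟩
    β * (x * y) + (x * x - β * (x * y) + y * y)   ≈⟨ +-congˡ (x-y≈z⇒x≈z+y (x-y≈z⇒x≈z+y eq)) ⟩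
    β * (x * y) + (0# + ϱ + γ * (x + y))          ≈⟨ +-congˡ (+-congʳ (+-identityˡ ϱ)) ⟩
    β * (x * y) + (ϱ + γ * (x + y))               ≈⟨ +-congˡ (+-comm ϱ _) ⟩
    β * (x * y) + (γ * (x + y) + ϱ)               ∎

  -- Subtracting the two instances, which share y, leaves x² - z² = (βy + γ)(x - z), and the factor
  -- x - z cancels.
  QuadraticZero⇒threeTerm : ∀ {β γ ϱ x y z} → x ≉ z →
    QuadraticZero β γ ϱ y x → QuadraticZero β γ ϱ z y → x + z ≈ β * y + γ
  QuadraticZero⇒threeTerm {β} {γ} {ϱ} {x} {y} {z} x≉z yx zy =
    *-cancelˡ-nonZero (x≉z ∘ x∙y⁻¹≈ε⇒x≈y x z) (+-cancelʳ (z * z + s * z) _ _ (begin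
      -- Writing x as n + z hides the difference in the atom `n`, so the semiring solver can expand;
      -- the summand z² + sz clears the remaining subtractions.
      n * (x + z) + (z * z + s * z)             ≈⟨ +-congʳ (*-congˡ (+-congʳ x≈n+z)) ⟩
      n * (n + z + z) + (z * z + s * z)         ≈⟨ solve 3 (λ n z s →
                                                     n :* (n :+ z :+ z) :+ (z :* z :+ s :* z)
                                                     := (n :+ z) :* (n :+ z) :+ s :* z) refl n z s ⟩
      (n + z) * (n + z) + s * z                 ≈⟨ +-congʳ (*-cong x≈n+z x≈n+z) ⟨
      x * x + s * z                             ≈⟨ difference ⟩
      z * z + s * x                             ≈⟨ +-congˡ (*-congˡ x≈n+z) ⟩
      z * z + s * (n + z)                       ≈⟨ solve 3 (λ n z s →
                                                     z :* z :+ s :* (n :+ z)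
                                                     := n :* s :+ (z :* z :+ s :* z)) refl n z s ⟩
      n * s + (z * z + s * z)                   ∎))
    where
    n s : Carrier
    n = x - z
    s = β * y + γ

    x≈n+z : x ≈ n + z
    x≈n+z = sym (x-y+y≈x x z)

    difference : x * x + s * z ≈ z * z + s * x
    -- The added y² + γy + ϱ completes each side to the left side of one instance plus the right
    -- side of the other.
    difference = +-cancelʳ (y * y + (γ * y + ϱ)) _ _ (begin
      x * x + s * z + (y * y + (γ * y + ϱ))
        ≈⟨ solve 6 (λ β γ ϱ x y z →
             x :* x :+ (β :* y :+ γ) :* z :+ (y :* y :+ (γ :* y :+ ϱ))
             := y :* y :+ x :* x :+ (β :* (z :* y) :+ (γ :* (z :+ y) :+ ϱ)))
             refl β γ ϱ x y z ⟩
      y * y + x * x + (β * (z * y) + (γ * (z + y) + ϱ))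
        ≈⟨ +-cong yx (sym zy) ⟩
      β * (y * x) + (γ * (y + x) + ϱ) + (z * z + y * y)
        ≈⟨ solve 6 (λ β γ ϱ x y z →
             β :* (y :* x) :+ (γ :* (y :+ x) :+ ϱ) :+ (z :* z :+ y :* y)
             := z :* z :+ (β :* y :+ γ) :* x :+ (y :* y :+ (γ :* y :+ ϱ)))
             refl β γ ϱ x y z ⟩
      z * z + s * x + (y * y + (γ * y + ϱ)) ∎)

  -- Adding the first equation to the reverse of the second puts one γ on each side, where it
  -- cancels.
  threeTerm⇒recurrence : ∀ {β γ x y z w} →
    x + z ≈ β * y + γ → y + w ≈ β * z + γ →
    x - (β + 1#) * y + (β + 1#) * z - w ≈ 0#
  threeTerm⇒recurrence {β} {γ} {x} {y} {z} {w} xz yw = begin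
    x - b * y + b * z - w                 ≈⟨ solve 4 (λ x n m v →
                                               x :+ n :+ m :+ v := x :+ m :+ (n :+ v))
                                               refl x (- (b * y)) (b * z) (- w) ⟩
    x + b * z + (- (b * y) - w)           ≈⟨ +-congʳ eliminated ⟩
    b * y + w + (- (b * y) - w)           ≈⟨ solve 4 (λ m w n v →
                                               m :+ w :+ (n :+ v) := m :+ n :+ (w :+ v))
                                               refl (b * y) w (- (b * y)) (- w) ⟩
    (b * y - b * y) + (w - w)             ≈⟨ +-cong (-‿inverseʳ (b * y)) (-‿inverseʳ w) ⟩
    0# + 0#                               ≈⟨ +-identityˡ 0# ⟩
    0#                                    ∎
    where
    b : Carrier
    b = β + 1#

    eliminated : x + b * z ≈ b * y + w
    eliminated = +-cancelʳ γ _ _ (begin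
      x + b * z + γ             ≈⟨ solve 4 (λ β γ x z →
                                     x :+ (β :+ con 1) :* z :+ γ := x :+ z :+ (β :* z :+ γ))
                                     refl β γ x z ⟩
      x + z + (β * z + γ)       ≈⟨ +-cong xz (sym yw) ⟩
      β * y + γ + (y + w)       ≈⟨ solve 4 (λ β γ y w →
                                     β :* y :+ γ :+ (y :+ w) := (β :+ con 1) :* y :+ w :+ γ)
                                     refl β γ y w ⟩
      b * y + w + γ             ∎)

-- Endomorphisms that are determined on eigenspaces.

module EndProperties {c ℓ₁ ℓ₂ m ℓm : Level} (F : HeytingField c ℓ₁ ℓ₂) (V : VectorSpace F m ℓm) where

  open OverVectorSpace F V
  open End
  open CommutativeRing (fieldRing F) hiding (zero)
  open FieldProperties F
  open Module V
  open SetoidReasoning ≈ᴹ-setoid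

  -ᴹ-*ₗ : ∀ s v → -ᴹ (s *ₗ v) ≈ᴹ (- s) *ₗ v
  -ᴹ-*ₗ s v = ≈ᴹ-sym (uniqueʳ‿-ᴹ (s *ₗ v) ((- s) *ₗ v)
    (≈ᴹ-trans (≈ᴹ-sym (*ₗ-distribʳ v s (- s)))
      (≈ᴹ-trans (*ₗ-congʳ (-‿inverseʳ s)) (*ₗ-zeroˡ v))))

  -- An inverse of `s` would force `f` to vanish; no vector with nonzero image has to be exhibited.
  annihilator≈0 : ∀ {s} {f : End} → f ≉ᴱ 0ᴱ → s ·ᴱ f ≈ᴱ 0ᴱ → s ≈ 0#
  annihilator≈0 {s} {f} f≉0 sf≈0 = noLeftInverse⇒≈0 λ t ts≈1 → f≉0 λ v → begin
    ⟦ f ⟧ v             ≈⟨ *ₗ-identityˡ _ ⟨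
    1# *ₗ ⟦ f ⟧ v       ≈⟨ *ₗ-congʳ ts≈1 ⟨
    (t * s) *ₗ ⟦ f ⟧ v  ≈⟨ *ₗ-assoc t s _ ⟩
    t *ₗ s *ₗ ⟦ f ⟧ v   ≈⟨ *ₗ-congˡ (sf≈0 v) ⟩
    t *ₗ 0ᴹ             ≈⟨ *ₗ-zeroʳ t ⟩
    0ᴹ                  ∎

  agreeOnLinearCombination : ∀ (f g : End) {n} (a : Fin n → Carrier) (b : Fin n → Carrierᴹ) →
    (∀ i → ⟦ f ⟧ (b i) ≈ᴹ ⟦ g ⟧ (b i)) →
    ⟦ f ⟧ (linearCombination a b) ≈ᴹ ⟦ g ⟧ (linearCombination a b)
  agreeOnLinearCombination f g {zero}  a b f≈g = ≈ᴹ-trans (0ᴹ-homo f) (≈ᴹ-sym (0ᴹ-homo g))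
  agreeOnLinearCombination f g {suc n} a b f≈g = begin
    ⟦ f ⟧ (a zero *ₗ b zero +ᴹ rest)           ≈⟨ +ᴹ-homo f _ _ ⟩
    ⟦ f ⟧ (a zero *ₗ b zero) +ᴹ ⟦ f ⟧ rest     ≈⟨ +ᴹ-cong head (agreeOnLinearCombination f g _ _ (f≈g ∘ suc)) ⟩
    ⟦ g ⟧ (a zero *ₗ b zero) +ᴹ ⟦ g ⟧ rest     ≈⟨ +ᴹ-homo g _ _ ⟨
    ⟦ g ⟧ (a zero *ₗ b zero +ᴹ rest)           ∎
    where
    rest : Carrierᴹ
    rest = linearCombination (a ∘ suc) (b ∘ suc)

    head : ⟦ f ⟧ (a zero *ₗ b zero) ≈ᴹ ⟦ g ⟧ (a zero *ₗ b zero)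
    head = ≈ᴹ-trans (*ₗ-homo f _ _) (≈ᴹ-trans (*ₗ-congˡ (f≈g zero)) (≈ᴹ-sym (*ₗ-homo g _ _)))

  -- Diagonalizability supplies an eigenbasis, and exhaustiveness of the ordering places each basis
  -- vector in a listed eigenspace.
  agreeOnEigenspaces : ∀ {A n} {θ : Fin n → Carrier} →
    MultiplicityFree A → IsEigenvalueOrdering A θ → (f g : End) →
    (∀ j v → Eigenspace A (θ j) v → ⟦ f ⟧ v ≈ᴹ ⟦ g ⟧ v) → f ≈ᴱ g
  agreeOnEigenspaces A-mf ordering f g f≈g v =
    let (_ , b , b-basis , b-eigen) = MultiplicityFree.diagonalizable A-mf
        (a , v≈ab) = IsBasis.spanning b-basis v _
        f≈g-on-b = λ i →
          let (μ , b≉0 , Ab≈μb) = b-eigen i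
              (j , μ≈θj) = IsEigenvalueOrdering.exhaustive ordering μ (b i , b≉0 , Ab≈μb)
          in f≈g j (b i) (≈ᴹ-trans Ab≈μb (*ₗ-congʳ μ≈θj))
    in ≈ᴹ-trans (⟦⟧-cong f v≈ab)
         (≈ᴹ-trans (agreeOnLinearCombination f g a b f≈g-on-b) (≈ᴹ-sym (⟦⟧-cong g v≈ab)))

  -- Primitive idempotents as eigenvectors, and weights of words.

  module _ {A : End} {n} {E : Fin n → End}
           (A-mf : MultiplicityFree A) (idempotents : ArePrimitiveIdempotents A E) where

    open ArePrimitiveIdempotents idempotents renaming (eigenvalueAt to θ)
    open IsEigenvalueOrdering eigenspaceOrdering

    idempotent≉0 : ∀ i → E i ≉ᴱ 0ᴱ
    idempotent≉0 i Ei≈0 =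
      let (v , v≉0 , Av≈θv) = isEigenvalue i
      in v≉0 (≈ᴹ-trans (≈ᴹ-sym (identityOnOwn i v Av≈θv)) (Ei≈0 v))

    A∘E≈θ·E : ∀ i → A ∘ᴱ E i ≈ᴱ θ i ·ᴱ E i
    A∘E≈θ·E i = agreeOnEigenspaces A-mf eigenspaceOrdering (A ∘ᴱ E i) (θ i ·ᴱ E i) onEigenspace
      where
      onEigenspace : ∀ j v → Eigenspace A (θ j) v → ⟦ A ⟧ (⟦ E i ⟧ v) ≈ᴹ θ i *ₗ ⟦ E i ⟧ v
      onEigenspace j v Av≈θv with j ≟ i
      ... | yes ≡.refl = begin
        ⟦ A ⟧ (⟦ E i ⟧ v)  ≈⟨ ⟦⟧-cong A (identityOnOwn i v Av≈θv) ⟩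
        ⟦ A ⟧ v            ≈⟨ Av≈θv ⟩
        θ i *ₗ v           ≈⟨ *ₗ-congˡ (identityOnOwn i v Av≈θv) ⟨
        θ i *ₗ ⟦ E i ⟧ v   ∎
      ... | no j≢i = begin
        ⟦ A ⟧ (⟦ E i ⟧ v)  ≈⟨ ⟦⟧-cong A (zeroOnOthers i j v j≢i Av≈θv) ⟩
        ⟦ A ⟧ 0ᴹ           ≈⟨ 0ᴹ-homo A ⟩
        0ᴹ                 ≈⟨ *ₗ-zeroʳ (θ i) ⟨
        θ i *ₗ 0ᴹ          ≈⟨ *ₗ-congˡ (zeroOnOthers i j v j≢i Av≈θv) ⟨
        θ i *ₗ ⟦ E i ⟧ v   ∎

    -- `A` is scalar on each eigenspace, which `E i` either fixes or kills. This makes `E i` a left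
    -- eigenvector of `A`.
    E∘A≈θ·E : ∀ i → E i ∘ᴱ A ≈ᴱ θ i ·ᴱ E i
    E∘A≈θ·E i = agreeOnEigenspaces A-mf eigenspaceOrdering (E i ∘ᴱ A) (θ i ·ᴱ E i) onEigenspace
      where
      onEigenspace : ∀ j v → Eigenspace A (θ j) v → ⟦ E i ⟧ (⟦ A ⟧ v) ≈ᴹ θ i *ₗ ⟦ E i ⟧ v
      onEigenspace j v Av≈θv with j ≟ i
      ... | yes ≡.refl = ≈ᴹ-trans (⟦⟧-cong (E i) Av≈θv) (*ₗ-homo (E i) (θ i) v)
      ... | no j≢i = begin
        ⟦ E i ⟧ (⟦ A ⟧ v)     ≈⟨ ⟦⟧-cong (E i) Av≈θv ⟩
        ⟦ E i ⟧ (θ j *ₗ v)    ≈⟨ *ₗ-homo (E i) (θ j) v ⟩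
        θ j *ₗ ⟦ E i ⟧ v      ≈⟨ *ₗ-congˡ (zeroOnOthers i j v j≢i Av≈θv) ⟩
        θ j *ₗ 0ᴹ             ≈⟨ *ₗ-zeroʳ (θ j) ⟩
        0ᴹ                    ≈⟨ *ₗ-zeroʳ (θ i) ⟨
        θ i *ₗ 0ᴹ             ≈⟨ *ₗ-congˡ (zeroOnOthers i j v j≢i Av≈θv) ⟨
        θ i *ₗ ⟦ E i ⟧ v      ∎

    isEigenvalueSequence : IsEigenvalueSequence A E θ
    isEigenvalueSequence i = idempotent≉0 i , A∘E≈θ·E i

  -- P is a left eigenvector of X with eigenvalue s, and w a right one with
  -- eigenvalue t, so P sends every word in X and Y of degree one in Y,
  -- applied to w, to a multiple of P Y w.
  module _ {X Y P : End} {s t : Carrier} {w : Carrierᴹ}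
           (P∘X≈sP : P ∘ᴱ X ≈ᴱ s ·ᴱ P) (Xw≈tw : ⟦ X ⟧ w ≈ᴹ t *ₗ w) where

    HasWeight : End → Carrier → Set ℓm
    HasWeight f a = ⟦ P ⟧ (⟦ f ⟧ w) ≈ᴹ a *ₗ ⟦ P ⟧ (⟦ Y ⟧ w)

    weight-Y : HasWeight Y 1#
    weight-Y = ≈ᴹ-sym (*ₗ-identityˡ _)

    weight-X∘ : ∀ f {a} → HasWeight f a → HasWeight (X ∘ᴱ f) (s * a)
    weight-X∘ f {a} Pf = ≈ᴹ-trans (P∘X≈sP _) (≈ᴹ-trans (*ₗ-congˡ Pf) (≈ᴹ-sym (*ₗ-assoc s a _)))

    weight-∘X : ∀ f {a} → HasWeight f a → HasWeight (f ∘ᴱ X) (t * a)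
    weight-∘X f {a} Pf = begin
      ⟦ P ⟧ (⟦ f ⟧ (⟦ X ⟧ w))          ≈⟨ ⟦⟧-cong P (⟦⟧-cong f Xw≈tw) ⟩
      ⟦ P ⟧ (⟦ f ⟧ (t *ₗ w))           ≈⟨ *ₗ-homo (P ∘ᴱ f) t w ⟩
      t *ₗ ⟦ P ⟧ (⟦ f ⟧ w)             ≈⟨ *ₗ-congˡ Pf ⟩
      t *ₗ a *ₗ ⟦ P ⟧ (⟦ Y ⟧ w)        ≈⟨ *ₗ-assoc t a _ ⟨
      (t * a) *ₗ ⟦ P ⟧ (⟦ Y ⟧ w)       ∎

    weight-+ : ∀ f g {a b} → HasWeight f a → HasWeight g b → HasWeight (f +ᴱ g) (a + b)
    weight-+ f g {a} {b} Pf Pg =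
      ≈ᴹ-trans (+ᴹ-homo P _ _) (≈ᴹ-trans (+ᴹ-cong Pf Pg) (≈ᴹ-sym (*ₗ-distribʳ _ a b)))

    weight-- : ∀ f g {a b} → HasWeight f a → HasWeight g b → HasWeight (f -ᴱ g) (a - b)
    weight-- f g {a} {b} Pf Pg = weight-+ f (-ᴱ g) Pf
      (≈ᴹ-trans (-ᴹ-homo P _) (≈ᴹ-trans (-ᴹ‿cong Pg) (-ᴹ-*ₗ b _)))

    weight-· : ∀ r f {a} → HasWeight f a → HasWeight (r ·ᴱ f) (r * a)
    weight-· r f {a} Pf =
      ≈ᴹ-trans (*ₗ-homo P r _) (≈ᴹ-trans (*ₗ-congˡ Pf) (≈ᴹ-sym (*ₗ-assoc r a _)))

    weight-≈ : ∀ f {a b} → a ≈ b → HasWeight f a → HasWeight f b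
    weight-≈ f a≈b Pf = ≈ᴹ-trans Pf (*ₗ-congʳ a≈b)

    -- Each `X` left of `Y` contributes a factor s and each one to the right a factor t, so the
    -- inner expression has weight p(s, t) and the commutator multiplies it by s - t.
    weight-TDExpression : ∀ β γ ϱ →
      HasWeight (TDExpression β γ ϱ X Y)
        (s * quadratic β γ ϱ s t - t * quadratic β γ ϱ s t)
    weight-TDExpression β γ ϱ = weight-- (X ∘ᴱ Z) (Z ∘ᴱ X) (weight-X∘ Z PZ) (weight-∘X Z PZ)
      where
      XXY XYX YXX XY+YX Z : End
      XXY = X ∘ᴱ X ∘ᴱ Y
      XYX = X ∘ᴱ Y ∘ᴱ X
      YXX = Y ∘ᴱ X ∘ᴱ X
      XY+YX = X ∘ᴱ Y +ᴱ Y ∘ᴱ X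
      Z = XXY -ᴱ β ·ᴱ XYX +ᴱ YXX -ᴱ γ ·ᴱ XY+YX -ᴱ ϱ ·ᴱ Y

      PXY : HasWeight (X ∘ᴱ Y) s
      PXY = weight-≈ (X ∘ᴱ Y) (*-identityʳ s) (weight-X∘ Y weight-Y)

      PYX : HasWeight (Y ∘ᴱ X) t
      PYX = weight-≈ (Y ∘ᴱ X) (*-identityʳ t) (weight-∘X Y weight-Y)

      PXYX : HasWeight XYX (s * t)
      -- Both bracketings of the composite compute to the same function, so associativity needs no
      -- proof; likewise for XXY and YXX below.
      PXYX = weight-X∘ (Y ∘ᴱ X) PYX

      PZ : HasWeight Z (quadratic β γ ϱ s t)
      PZ = weight-- (XXY -ᴱ β ·ᴱ XYX +ᴱ YXX -ᴱ γ ·ᴱ XY+YX) (ϱ ·ᴱ Y)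
        (weight-- (XXY -ᴱ β ·ᴱ XYX +ᴱ YXX) (γ ·ᴱ XY+YX)
          (weight-+ (XXY -ᴱ β ·ᴱ XYX) YXX
            (weight-- XXY (β ·ᴱ XYX) (weight-X∘ (X ∘ᴱ Y) PXY) (weight-· β XYX PXYX))
            (weight-∘X (Y ∘ᴱ X) PYX))
          (weight-· γ XY+YX (weight-+ (X ∘ᴱ Y) (Y ∘ᴱ X) PXY PYX)))
        (weight-≈ (ϱ ·ᴱ Y) (*-identityʳ ϱ) (weight-· ϱ Y weight-Y))

  -- Relations between consecutive eigenvalues.

  module _ {n} {X Y : End} {E : Fin (suc n) → End}
           (X-mf : MultiplicityFree X) (idempotents : ArePrimitiveIdempotents X E)
           (EYE-nonzero : ∀ i j → toℕ i ≡ suc (toℕ j) → E i ∘ᴱ Y ∘ᴱ E j ≉ᴱ 0ᴱ)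
           {β γ ϱ : Carrier} (TD-relation : 0ᴱ ≈ᴱ TDExpression β γ ϱ X Y) where

    open ArePrimitiveIdempotents idempotents renaming (eigenvalueAt to θ)
    open IsEigenvalueOrdering eigenspaceOrdering

    θ-distinct : ∀ {i j} → i ≢ j → θ i ≉ θ j
    θ-distinct i≢j θi≈θj = i≢j (distinct θi≈θj)

    consecutive-QuadraticZero : ∀ i j → toℕ i ≡ suc (toℕ j) → QuadraticZero β γ ϱ (θ i) (θ j)
    consecutive-QuadraticZero i j i≡1+j = quadratic≈0⇒QuadraticZero (*-cancelˡ-≉ q
      (θ-distinct i≢j)
      (trans (*-comm q (θ i)) (trans (x-y≈z⇒x≈z+y differenceKills)
        (trans (+-identityˡ _) (*-comm (θ j) q)))))
      where
      q : Carrier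
      q = quadratic β γ ϱ (θ i) (θ j)

      i≢j : i ≢ j
      i≢j ≡.refl = m≢1+n+m (toℕ i) {0} i≡1+j

      differenceKills : θ i * q - θ j * q ≈ 0#
      differenceKills = annihilator≈0 {f = E i ∘ᴱ Y ∘ᴱ E j} (EYE-nonzero i j i≡1+j) λ v → begin
        (θ i * q - θ j * q) *ₗ ⟦ E i ⟧ (⟦ Y ⟧ (⟦ E j ⟧ v))
          -- The weight lemma is used with P = `E i` and w = `E j` v.
          ≈⟨ weight-TDExpression {X} {Y} {E i} (E∘A≈θ·E X-mf idempotents i)
               (A∘E≈θ·E X-mf idempotents j v) β γ ϱ ⟨
        ⟦ E i ⟧ (⟦ TDExpression β γ ϱ X Y ⟧ (⟦ E j ⟧ v))
          ≈⟨ ⟦⟧-cong (E i) (TD-relation (⟦ E j ⟧ v)) ⟨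
        ⟦ E i ⟧ 0ᴹ
          ≈⟨ 0ᴹ-homo (E i) ⟩
        0ᴹ ∎

    consecutive-threeTerm : ∀ h i j → toℕ i ≡ suc (toℕ h) → toℕ j ≡ suc (toℕ i) →
      θ h + θ j ≈ β * θ i + γ
    consecutive-threeTerm h i j i≡1+h j≡1+i = QuadraticZero⇒threeTerm (θ-distinct h≢j)
      -- The larger index comes first, since the blocks assumed nonzero are those just below the
      -- diagonal.
      (consecutive-QuadraticZero i h i≡1+h) (consecutive-QuadraticZero j i j≡1+i)
      where
      h≢j : h ≢ j
      -- The implicit 1 encodes a gap of two between the indices.
      h≢j ≡.refl = m≢1+n+m (toℕ h) {1} (≡.trans j≡1+i (≡.cong suc i≡1+h))

    TD⇒recurrent : IsRecurrentWith β θ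
    TD⇒recurrent h i j k i≡1+h j≡1+i k≡1+j = threeTerm⇒recurrence
      (consecutive-threeTerm h i j i≡1+h j≡1+i) (consecutive-threeTerm i j k j≡1+i k≡1+j)

mainTheorem3 : ∀ {c ℓ₁ ℓ₂ m ℓm : Level} (d : ℕ) → d ≥ 2 →
    (F : HeytingField c ℓ₁ ℓ₂) (V : VectorSpace F m ℓm) →
    let open OverVectorSpace F V in
    HasDimension (suc d) → (Φ : HessenbergSystem d) → TD Φ → Recurrent Φ
mainTheorem3 d _ F V _ Φ (β , γ , γ* , ϱ , ϱ* , A-relation , A*-relation) =
  eigenvalueAt E-primitiveIdempotents , eigenvalueAt E*-primitiveIdempotents ,
  isEigenvalueSequence A-multiplicityFree E-primitiveIdempotents ,
  isEigenvalueSequence A*-multiplicityFree E*-primitiveIdempotents ,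
  -- Both TD relations carry the same β, so one witness serves both sequences; the dual one follows
  -- by exchanging `A` and `A*`.
  β ,
  TD⇒recurrent {Y = A*} A-multiplicityFree E-primitiveIdempotents EA*E-nonzero A-relation ,
  TD⇒recurrent {Y = A} A*-multiplicityFree E*-primitiveIdempotents E*AE*-nonzero A*-relation
  where
  open OverVectorSpace F V
  open HessenbergSystem Φ
  open ArePrimitiveIdempotents using (eigenvalueAt)
  open EndProperties F V
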